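{- Let $X$ be a standard Borel space and let $\Gamma$ be a Borel graph on $X$. Let $d\ge2$. Suppose that there is a bounded geometry weakly orthogonal decomposition of $X$ (with respect to $\Gamma$) with polygonal bound $P$ and orthogonality constant $Q$ satisfying $d\cdot P\le Q$. Then there is a Borel unlayered toast on $X$ (with respect to $\Gamma$).
   Context: $\rho_\Gamma$ denotes the shortest-path-length metric on the connected components of $\Gamma$ (distance $\infty$ between points of different components, and to the empty set); distances between sets are infima. For a sequence $(X_k)_{k\ge1}$ of Borel subsets of $X$ write $X_k^\infty=\bigcup_{n\ge k}X_n$. The sequence is a weakly orthogonal decomposition of $X$ if (i) for every $k$ every connected component of $\Gamma\restriction(X\setminus X_k^\infty)$ is finite, and $\bigcap_{k\ge1}X_k^\infty=\varnothing$; and (ii) there is a constant $Q$ such that for every $k\ge1$, every connected component $R$ of $\Gamma\restriction(X\setminus X_k^\infty)$ and every $n\ge k$: $\rho_\Gamma(R,X_n^\infty)\le Q\Rightarrow\rho_\Gamma(R,X_n^\infty)=1$. It has bounded geometry if moreover (iii) there is a constant $P$ such that for every $k\ge1$ and every connected component $R$ of $\Gamma\restriction(X\setminus X_k^\infty)$, $|\{n\ge k:\rho_\Gamma(R,X_n)=1\}|\le P$. "With polygonal bound $P$ and orthogonality constant $Q$" means that $P$ is the smallest constant for which (iii) holds and $Q$ is a constant for which (ii) holds. Let $E_\Gamma$ be the equivalence relation on $X$ whose classes are the connected components of $\Gamma$. A sequence $\{T_n\}$, where each $T_n\subseteq E_\Gamma$ is an equivalence relation on a subset $\mathrm{dom}(T_n)$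 of $X$, is an (unlayered) toast if: (1) each $T_n$-class is finite; (2) $\bigcup_n\mathrm{dom}(T_n)=X$; (3) for each $T_n$-class $C$ and each $T_m$-class $C'$ with $m>n$, if $C\cap C'\ne\varnothing$ then $C\subseteq C'$; (4) for each $T_n$-class $C$ there are $m>n$ and a $T_m$-class $C'$ with $C\subseteq C'\setminus\partial C'$, where $\partial C'=\{x\in C':\rho_\Gamma(x,X\setminus C')=1\}$. It is Borel if each $\mathrm{dom}(T_n)$ is Borel and each $T_n$ is a Borel equivalence relation on $\mathrm{dom}(T_n)$. -}

module Defs where

open import Data.List.Base using (List; length)
open import Data.List.Membership.Propositional using () renaming (_∈_ to _∈ˡ_)
open import Data.Maybe.Base using (Maybe; just)
open import Data.Nat.Base as ℕ using (ℕ; zero; suc)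
open import Data.Product.Base using (Σ-syntax; ∃; ∃-syntax; ∃₂; _×_; _,_; proj₁; proj₂)
open import Data.Rational.Base as ℚ using (ℚ; 0ℚ; 1ℚ)
import Data.Rational.Properties as ℚ
open import Function.Bundles using (_⇔_)
open import Function.Metric.Structures using (IsGeneralMetric)
open import Level using (Level; 0ℓ)
open import Relation.Binary.Core using (Rel; _⇒_)
open import Relation.Binary.Construct.Closure.ReflexiveTransitive using (Star; fold)
open import Relation.Binary.Definitions using (Symmetric)
open import Relation.Binary.PropositionalEquality.Core using (_≡_)
open import Relation.Binary.Structures using (IsPartialEquivalence)
open import Relation.Nullary.Negation.Core using (¬_)
open import Relation.Unary using (Pred; _∈_; _∉_; _⊆_; _≐_; ∁; ∅; ⋃; ｛_｝; _∩_; Satisfiable)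

------------------------------------------------------------------------
-- Nonnegative reals

-- A real r ≥ 0 is represented by its open upper cut { q ∈ ℚ ∣ r < q }.

record ℝ≥0 : Set₁ where
  field
    Above     : Pred ℚ 0ℓ
    inhabited : ∃ Above
    positive  : ∀ {q} → q ∈ Above → 0ℚ ℚ.< q
    upward    : ∀ {p q} → p ∈ Above → p ℚ.≤ q → q ∈ Above
    rounded   : ∀ {q} → q ∈ Above → ∃[ p ] p ∈ Above × p ℚ.< q

open ℝ≥0

infix 4 _≤ᴿ_ _≈ᴿ_ _<ᴿ_
infixl 6 _+ᴿ_

_≤ᴿ_ _≈ᴿ_ : Rel ℝ≥0 0ℓ
r ≤ᴿ s = Above s ⊆ Above r
r ≈ᴿ s = Above r ≐ Above s

_<ᴿ_ : ℝ≥0 → ℚ → Set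
r <ᴿ q = q ∈ Above r

0ᴿ : ℝ≥0
0ᴿ = record
  { Above     = 0ℚ ℚ.<_
  ; inhabited = 1ℚ , ℚ.positive⁻¹ 1ℚ
  ; positive  = λ 0<q → 0<q
  ; upward    = ℚ.<-≤-trans
  ; rounded   = λ 0<q → let p , 0<p , p<q = ℚ.<-dense 0<q in p , 0<p , p<q
  }

_+ᴿ_ : ℝ≥0 → ℝ≥0 → ℝ≥0
r +ᴿ s = record
  { Above     = λ q → ∃₂ λ a b → a ∈ Above r × b ∈ Above s × a ℚ.+ b ℚ.≤ q
  ; inhabited =
      let a , a∈r = inhabited r
          b , b∈s = inhabited s
      in a ℚ.+ b , a , b , a∈r , b∈s , ℚ.≤-refl
  ; positive  = λ (a , b , a∈r , b∈s , a+b≤q) →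
      ℚ.<-≤-trans (ℚ.+-mono-< (positive r a∈r) (positive s b∈s)) a+b≤q
  ; upward    = λ (a , b , a∈r , b∈s , a+b≤p) p≤q →
      a , b , a∈r , b∈s , ℚ.≤-trans a+b≤p p≤q
  ; rounded   = λ (a , b , a∈r , b∈s , a+b≤q) →
      let a′ , a′∈r , a′<a = rounded r a∈r
      in a′ ℚ.+ b , (a′ , b , a′∈r , b∈s , ℚ.≤-refl)
       , ℚ.<-≤-trans (ℚ.+-monoˡ-< b a′<a) a+b≤q
  }

------------------------------------------------------------------------
-- Standard Borel spaces

-- Subsets of A are predicates A → Set, identified up to _≐_; hence the
-- constructor respects.

data σ⟨_⟩ {A : Set} {ℓ : Level} (G : Pred (Pred A 0ℓ) ℓ) :
          Pred (Pred A 0ℓ) (Level.suc 0ℓ Level.⊔ ℓ) where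
  generator  : ∀ {U} → G U → σ⟨ G ⟩ U
  empty      : σ⟨ G ⟩ ∅
  complement : ∀ {U} → σ⟨ G ⟩ U → σ⟨ G ⟩ (∁ U)
  union      : ∀ {U : ℕ → Pred A 0ℓ} → (∀ n → σ⟨ G ⟩ (U n)) → σ⟨ G ⟩ (⋃ ℕ U)
  respects   : ∀ {U V} → U ≐ V → σ⟨ G ⟩ U → σ⟨ G ⟩ V

record PolishMetric (A : Set) : Set₁ where
  field
    d        : A → A → ℝ≥0
    isMetric : IsGeneralMetric _≡_ _≈ᴿ_ _≤ᴿ_ 0ᴿ _+ᴿ_ d

  Cauchy : (ℕ → A) → Set
  Cauchy s = ∀ ε → 0ℚ ℚ.< ε →
    ∃[ N ] ∀ m n → N ℕ.≤ m → N ℕ.≤ n → d (s m) (s n) <ᴿ ε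

  ConvergesTo : (ℕ → A) → A → Set
  ConvergesTo s x = ∀ ε → 0ℚ ℚ.< ε → ∃[ N ] ∀ n → N ℕ.≤ n → d (s n) x <ᴿ ε

  field
    complete  : ∀ s → Cauchy s → ∃ (ConvergesTo s)
    -- A countable dense set is the set of values of an enumeration that
    -- may skip indices, so that the empty space is not excluded.
    separable : Σ[ e ∈ (ℕ → Maybe A) ] (∀ x ε → 0ℚ ℚ.< ε →
                  ∃₂ λ n y → e n ≡ just y × d x y <ᴿ ε)

  Open : Pred (Pred A 0ℓ) 0ℓ
  Open U = ∀ x → x ∈ U → ∃[ ε ] 0ℚ ℚ.< ε × (∀ y → d x y <ᴿ ε → y ∈ U)

record StandardBorelSpace : Set₂ where
  field
    Carrier      : Set
    Borel        : Pred (Pred Carrier 0ℓ) (Level.suc 0ℓ)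
    polishMetric : PolishMetric Carrier
    Borel⇔σ⟨Open⟩ : ∀ U → Borel U ⇔ σ⟨ PolishMetric.Open polishMetric ⟩ U

  data Rectangle : Pred (Pred (Carrier × Carrier) 0ℓ) (Level.suc 0ℓ) where
    _⊗_ : ∀ {U V} → Borel U → Borel V → Rectangle (λ (x , y) → x ∈ U × y ∈ V)

  BorelRel : Pred (Rel Carrier 0ℓ) (Level.suc 0ℓ)
  BorelRel R = σ⟨ Rectangle ⟩ (λ (x , y) → R x y)

------------------------------------------------------------------------
-- Graphs

module _ {A : Set} where

  _↾_ : Rel A 0ℓ → Pred A 0ℓ → Rel A 0ℓ
  (Γ ↾ Y) x y = x ∈ Y × y ∈ Y × Γ x y

  -- The connected component of x in Γ; for x ∈ Y, component (Γ ↾ Y) x is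
  -- the component of x in the induced graph on Y.
  component : Rel A 0ℓ → A → Pred A 0ℓ
  component Γ x = Star Γ x

  pathLength : ∀ {Γ : Rel A 0ℓ} {x y} → Star Γ x y → ℕ
  pathLength = fold (λ _ _ → ℕ) (λ _ n → suc n) zero

  -- ρ_Γ(U, V) ∈ ℕ ∪ {∞}, the infimum of path lengths from U to V, is given
  -- by its comparisons with natural numbers n; it is ∞ if it is ≤ no n.
  ρ[_]_,_≤_ ρ[_]_,_≡_ : Rel A 0ℓ → Pred A 0ℓ → Pred A 0ℓ → ℕ → Set
  ρ[ Γ ] U , V ≤ n = ∃₂ λ x y → x ∈ U × y ∈ V × Σ[ p ∈ Star Γ x y ] pathLength p ℕ.≤ n
  ρ[ Γ ] U , V ≡ n = ρ[ Γ ] U , V ≤ n × (∀ m → ρ[ Γ ] U , V ≤ m → n ℕ.≤ m)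

  ∂[_] : Rel A 0ℓ → Pred A 0ℓ → Pred A 0ℓ
  ∂[ Γ ] C x = x ∈ C × ρ[ Γ ] ｛ x ｝ , ∁ C ≡ 1

-- ∣ U ∣ ≤ n
AtMost : {A : Set} → ℕ → Pred A 0ℓ → Set
AtMost n U = ∃[ xs ] length xs ℕ.≤ n × U ⊆ (_∈ˡ xs)

Finite : {A : Set} → Pred A 0ℓ → Set
Finite U = ∃[ n ] AtMost n U

module _ (𝕏 : StandardBorelSpace) where
  open StandardBorelSpace 𝕏 renaming (Carrier to X)

  record IsBorelGraph (Γ : Rel X 0ℓ) : Set₁ where
    field
      borel       : BorelRel Γ
      symmetric   : Symmetric Γ
      irreflexive : ∀ x → ¬ Γ x x

  -- Sequences (Xₖ) are indexed from k = 0 instead of k = 1.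
  infix 25 _^∞
  _^∞ : (ℕ → Pred X 0ℓ) → ℕ → Pred X 0ℓ
  (Xs ^∞) k x = ∃[ n ] k ℕ.≤ n × x ∈ Xs n

  module _ (Γ : Rel X 0ℓ) (Xs : ℕ → Pred X 0ℓ) where

    -- For x ∉ Xₖ^∞, the component of x in Γ ↾ (X ∖ Xₖ^∞).
    region : ℕ → X → Pred X 0ℓ
    region k = component (Γ ↾ ∁ ((Xs ^∞) k))

    OrthogonalityConstant : ℕ → Set
    OrthogonalityConstant Q = ∀ k x → x ∉ (Xs ^∞) k → ∀ n → k ℕ.≤ n →
      ρ[ Γ ] region k x , (Xs ^∞) n ≤ Q → ρ[ Γ ] region k x , (Xs ^∞) n ≡ 1

    BoundsPolygons : ℕ → Set
    BoundsPolygons P = ∀ k x → x ∉ (Xs ^∞) k →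
      AtMost P (λ n → k ℕ.≤ n × ρ[ Γ ] region k x , Xs n ≡ 1)

    PolygonalBound : ℕ → Set
    PolygonalBound P = BoundsPolygons P × (∀ P′ → BoundsPolygons P′ → P ℕ.≤ P′)

    -- A bounded geometry weakly orthogonal decomposition with polygonal
    -- bound P and orthogonality constant Q.
    record IsBoundedGeometryWOD (P Q : ℕ) : Set₁ where
      field
        borel                 : ∀ k → Borel (Xs k)
        finiteRegions         : ∀ k x → x ∉ (Xs ^∞) k → Finite (region k x)
        vanishing             : ∀ x → ¬ (∀ k → x ∈ (Xs ^∞) k)
        polygonalBound        : PolygonalBound P
        orthogonalityConstant : OrthogonalityConstant Q

  record IsEquivalenceOn (D : Pred X 0ℓ) (T : Rel X 0ℓ) : Set where
    field
      supported            : ∀ {x y} → T x y → x ∈ D × y ∈ D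
      reflexive            : ∀ {x} → x ∈ D → T x x
      isPartialEquivalence : IsPartialEquivalence T

  -- For x ∈ dom n, the predicate T n x is the T n-class of x.
  record BorelUnlayeredToast (Γ : Rel X 0ℓ) : Set₁ where
    field
      dom             : ℕ → Pred X 0ℓ
      T               : ℕ → Rel X 0ℓ
      isEquivalenceOn : ∀ n → IsEquivalenceOn (dom n) (T n)
      T⊆EΓ            : ∀ n → T n ⇒ Star Γ
      finiteClasses   : ∀ n x → x ∈ dom n → Finite (T n x)
      covers          : ∀ x → ∃[ n ] x ∈ dom n
      nested          : ∀ n m → n ℕ.< m → ∀ x x′ → x ∈ dom n → x′ ∈ dom m →
                        Satisfiable (T n x ∩ T m x′) → T n x ⊆ T m x′
      absorbed        : ∀ n x → x ∈ dom n → ∃[ m ] n ℕ.< m ×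
                        (∃[ x′ ] x′ ∈ dom m × T n x ⊆ T m x′ ∩ ∁ (∂[ Γ ] (T m x′)))
      borelDom        : ∀ n → Borel (dom n)
      borelT          : ∀ n → BorelRel (T n)

{-# OPTIONS --safe #-}
module Submission where

-- Take for Tₙ the component relation of Γ restricted to Yₙ = X ∖ Xₙ^∞. The Yₙ
-- increase to X, so the classes are finite and nested. A class C of Tₙ touches
-- X_k for only finitely many k ≥ n; beyond these, C together with all its
-- neighbours lies in Yₘ, so C misses the boundary of its class in Tₘ.
--
-- The work is in showing that Tₙ is Borel. It is the union over k of the k-fold
-- compositions of a Borel relation with finite sections. Such a relation is a
-- countable union of Borel partial functions (by Novikov separation of
-- analytic sets), and a Borel partial function has Borel domain (by Suslin
-- separation and completeness), whence its composition with any Borel relation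
-- is Borel, by induction on the latter.

open import Defs
open import Axiom.ExcludedMiddle using (ExcludedMiddle)
open import Data.Empty using (⊥-elim)
open import Data.Integer.Base as ℤ using (+_)
import Data.Integer.Properties as ℤ
import Data.Nat.Properties as ℕ
open import Data.List.Base using (List; []; _∷_; _++_; map)
open import Data.List.Extrema ℕ.≤-totalOrder using (max; xs≤max)
open import Data.List.Membership.Propositional using () renaming (_∈_ to _∈ˡ_)
open import Data.List.Relation.Binary.Subset.Propositional using () renaming (_⊆_ to _⊆ˡ_)
open import Data.List.Membership.Propositional.Properties using (∈-map⁺; ∈-++⁺ˡ; ∈-++⁺ʳ)
open import Data.List.Relation.Unary.All as All using ()
open import Data.List.Relation.Unary.Any using (here; there)
open import Data.Maybe.Base using (just)
open import Data.Maybe.Properties using (just-injective)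
open import Data.Nat.Base as ℕ using (ℕ; zero; suc; _*_; _≤_; _⊔_; z≤n; s≤s)
import Data.Nat.Coprimality as ℕ
open import Data.Product.Base using (Σ-syntax; ∃; ∃-syntax; ∃₂; _×_; _,_; proj₁; proj₂; uncurry)
open import Data.Rational.Base as ℚ using (ℚ; 0ℚ; 1ℚ; ½; mkℚ)
import Data.Rational.Properties as ℚ
open import Data.Sum.Base using (inj₁; inj₂; [_,_]′)
open import Data.Unit.Base using (⊤; tt)
open import Function.Base using (_∘_; id)
open import Function.Bundles using (Equivalence)
open import Function.Metric.Structures using (IsGeneralMetric)
open import Level using (Level; 0ℓ)
open import Relation.Binary.Core using (Rel)
open import Relation.Binary.Construct.Closure.ReflexiveTransitive as Star using (Star; _◅_; _◅◅_)
open import Relation.Binary.PropositionalEquality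
open import Relation.Nullary.Decidable.Core using (yes; no; decidable-stable)
open import Relation.Nullary.Negation.Core using (¬_; contradiction)
open import Relation.Unary using (Pred; _∈_; _∉_; _⊆_; _≐_; ∁; ∅; ⋃; ⋂; _∩_; _∪_; U; Satisfiable; Empty; _⟨×⟩_)

private variable
  ℓ : Level
  Z Z₁ Z₂ : Set

-- Enumerations

private
  -- Runs through an antidiagonal from `(0 , s)` to `(s , 0)` and then jumps to the start of the
  -- following one.
  next : ℕ × ℕ → ℕ × ℕ
  next (a , zero)  = zero , suc a
  next (a , suc b) = suc a , b

unpair : ℕ → ℕ × ℕ
unpair zero    = zero , zero
unpair (suc n) = next (unpair n)

private
  unpair-diagonal : ∀ s a b → a ℕ.+ b ≡ s → ∃[ n ] unpair n ≡ (a , b)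
  unpair-diagonal zero    zero    zero    refl = 0 , refl
  unpair-diagonal (suc s) zero    (suc .s) refl =
    let n , eq = unpair-diagonal s s 0 (ℕ.+-identityʳ s) in suc n , cong next eq
  unpair-diagonal s       (suc a) b eq =
    let n , eq′ = unpair-diagonal s a (suc b) (trans (ℕ.+-suc a b) eq)
    in suc n , cong next eq′

unpair-surjective : ∀ ab → ∃[ n ] unpair n ≡ ab
unpair-surjective (a , b) = unpair-diagonal (a ℕ.+ b) a b refl

private
  -- The length is a separate argument, so the recursion is structural; `enumerate` packs it into
  -- the index as well.
  decode : ℕ → ℕ → List ℕ
  decode zero    n = []
  decode (suc k) n = proj₁ (unpair n) ∷ decode k (proj₂ (unpair n))

  decode-surjective : ∀ l → ∃₂ λ k n → decode k n ≡ l
  decode-surjective []      = 0 , 0 , refl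
  decode-surjective (x ∷ l) =
    let k , n , eq  = decode-surjective l
        m , eq′     = unpair-surjective (x , n)
    in suc k , m , cong₂ _∷_ (cong proj₁ eq′) (trans (cong (decode k ∘ proj₂) eq′) eq)

enumerate : ℕ → ℕ × List ℕ
enumerate n = let a , b = unpair n in a , uncurry decode (unpair b)

enumerate-surjective : ∀ c → ∃[ n ] enumerate n ≡ c
enumerate-surjective (a , l) =
  let k , n , eq = decode-surjective l
      m , eq′    = unpair-surjective (k , n)
      t , eq″    = unpair-surjective (a , m)
  in t , cong₂ _,_ (cong proj₁ eq″)
           (trans (cong (uncurry decode ∘ unpair ∘ proj₂) eq″)
                  (trans (cong (uncurry decode) eq′) eq))

-- Null sequences of rationals

-- Abstract, since the unifier gets lost in unfolded rational arithmetic.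
abstract
  radius : ℕ → ℚ
  radius n = mkℚ (+ 1) n (ℕ.1-coprimeTo (suc n))

  radius-positive : ∀ n → 0ℚ ℚ.< radius n
  radius-positive n = ℚ.positive⁻¹ (radius n)

  radius-null : ∀ ε → 0ℚ ℚ.< ε → ∃[ N ] ∀ n → N ≤ n → radius n ℚ.< ε
  radius-null (mkℚ (+ zero) q c) 0<ε = contradiction 0<ε (ℚ.<-irrefl (sym (ℚ.↥p≡0⇒p≡0 _ refl)))
  -- `mkℚ` stores the denominator minus one, so `radius n` is 1/(n+1) and ε is (p+1)/(q+1), which is
  -- at least 1/(q+1).
  radius-null (mkℚ (+ suc p) q c) 0<ε = suc q , λ n q<n → ℚ.*<* (begin-strict
    + 1 ℤ.* + suc q        ≡⟨ ℤ.*-identityˡ (+ suc q) ⟩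
    + suc q                <⟨ ℤ.+<+ (s≤s q<n) ⟩
    + suc n                ≤⟨ ℤ.+≤+ (ℕ.m≤n*m (suc n) (suc p)) ⟩
    + (suc p * suc n)      ≡⟨ ℤ.pos-* (suc p) (suc n) ⟩
    + suc p ℤ.* + suc n    ∎)
    where open ℤ.≤-Reasoning
  radius-null (mkℚ (ℤ.-[1+_] p) q c) (ℚ.*<* ())

  half : ℚ → ℚ
  half ε = ε ℚ.* ½

  half-positive : ∀ {ε} → 0ℚ ℚ.< ε → 0ℚ ℚ.< half ε
  half-positive {ε} 0<ε = ℚ.<-respˡ-≡ (ℚ.*-zeroˡ ½) (ℚ.*-monoˡ-<-pos ½ 0<ε)

  half+half : ∀ ε → half ε ℚ.+ half ε ≡ ε
  half+half ε = trans (sym (ℚ.*-distribˡ-+ ε ½ ½)) (ℚ.*-identityʳ ε)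

  half≤ : ∀ {ε} → 0ℚ ℚ.< ε → half ε ℚ.≤ ε
  half≤ {ε} 0<ε = subst₂ ℚ._≤_ (ℚ.+-identityˡ (half ε)) (half+half ε)
    (ℚ.+-monoˡ-≤ (half ε) (ℚ.<⇒≤ (half-positive 0<ε)))


gap : ∀ {p q} → p ℚ.< q → ∃[ δ ] 0ℚ ℚ.< δ × δ ℚ.+ p ≡ q
gap {p} {q} p<q = q ℚ.- p
  , ℚ.<-respˡ-≡ (ℚ.+-inverseʳ p) (ℚ.+-monoˡ-< (ℚ.- p) p<q)
  , trans (ℚ.+-assoc q (ℚ.- p) p)
      (trans (cong (q ℚ.+_) (ℚ.+-inverseˡ p)) (ℚ.+-identityʳ q))

-- Excluded middle and closure properties of σ-algebras

module Classical (em : ∀ {ℓ} → ExcludedMiddle ℓ) where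

  dne : ∀ {P : Set ℓ} → ¬ ¬ P → P
  dne = decidable-stable em

  ¬∀⇒∃¬ : ∀ {a} {A : Set a} {P : A → Set ℓ} → ¬ (∀ x → P x) → ∃[ x ] ¬ P x
  ¬∀⇒∃¬ ¬∀ = dne λ ¬∃ → ¬∀ λ x → dne λ ¬P → ¬∃ (x , ¬P)

  module _ {G : Pred (Pred Z 0ℓ) ℓ} where

    σ-⋂ : ∀ {V : ℕ → Pred Z 0ℓ} → (∀ n → σ⟨ G ⟩ (V n)) → σ⟨ G ⟩ (⋂ ℕ V)
    σ-⋂ σV = respects ((λ ¬∃ n → dne λ ¬V → ¬∃ (n , ¬V)) , λ ∀V (n , ¬V) → ¬V (∀V n))
      (complement (union (complement ∘ σV)))

    -- By excluded middle the set is everything or nothing. Conditions that do not mention the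
    -- point, such as `m ≡ n`, may thus occur in Borel definitions.
    σ-const : ∀ (P : Set) → σ⟨ G ⟩ (λ _ → P)
    σ-const P with em {P = P}
    ... | yes p = respects ((λ _ → p) , λ _ ()) (complement empty)
    ... | no ¬p = respects ((λ ()) , ¬p) empty

    σ-∪ : ∀ {V W : Pred Z 0ℓ} → σ⟨ G ⟩ V → σ⟨ G ⟩ W → σ⟨ G ⟩ (V ∪ W)
    σ-∪ {V} {W} σV σW = respects
      ((λ { (zero , v) → inj₁ v ; (suc _ , w) → inj₂ w }) , λ { (inj₁ v) → 0 , v ; (inj₂ w) → 1 , w })
      (union {U = λ { zero → V ; (suc _) → W }} λ { zero → σV ; (suc _) → σW })

    σ-⇒ : ∀ {V W : Pred Z 0ℓ} → σ⟨ G ⟩ V → σ⟨ G ⟩ W → σ⟨ G ⟩ (λ x → x ∈ V → x ∈ W)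
    σ-⇒ {V} {W} σV σW = respects
      ( (λ { (inj₁ ¬v) v → contradiction v ¬v ; (inj₂ w) _ → w })
      , decide)
      (σ-∪ (complement σV) σW)
      where
      decide : ∀ {x} → (x ∈ V → x ∈ W) → x ∈ ∁ V ∪ W
      decide {x} f with em {P = x ∈ V}
      ... | yes v = inj₂ (f v)
      ... | no ¬v = inj₁ ¬v

    σ-∩ : ∀ {V W : Pred Z 0ℓ} → σ⟨ G ⟩ V → σ⟨ G ⟩ W → σ⟨ G ⟩ (V ∩ W)
    σ-∩ {V} {W} σV σW = respects
      ((λ f → f 0 , f 1) , λ { (v , w) zero → v ; (v , w) (suc _) → w })
      (σ-⋂ {V = λ { zero → V ; (suc _) → W }} λ { zero → σV ; (suc _) → σW })

  -- Analytic sets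

  Code : Set
  Code = List ℕ → ℕ

  Agree : List (List ℕ) → Code → Code → Set
  Agree L α β = ∀ {l} → l ∈ˡ L → α l ≡ β l

  -- The image under `F` of a basic neighbourhood of `α` in the product topology on codes: `L` is
  -- the finite set of positions at which the code is prescribed.
  Near : (Code → Pred Z 0ℓ) → Code → List (List ℕ) → Pred Z 0ℓ
  Near F α L z = ∃[ β ] Agree L α β × z ∈ F β

  -- A code is a tree-indexed sequence; its subtrees serve to pack countably
  -- many codes into one without any arithmetic of pairing functions.
  sub : ℕ → Code → Code
  sub n α l = α (n ∷ l)

  -- Phrased in terms of Near F α L only: the relation F from codes to points is a
  -- continuous function with closed domain. Analytic sets are the images of such F.
  Regular : (Z → ℕ → Pred Z 0ℓ) → (Code → Pred Z 0ℓ) → Set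
  Regular ball F = ∀ α → (∀ L → Satisfiable (Near F α L)) →
    ∃[ z ] z ∈ F α × (∀ n → ∃[ L ] Near F α L ⊆ ball z n)

  Analytic : (Z → ℕ → Pred Z 0ℓ) → Pred (Pred Z 0ℓ) (Level.suc 0ℓ)
  Analytic ball V = Σ[ F ∈ (Code → Pred _ 0ℓ) ] Regular ball F × V ≐ ⋃ Code F

  Separating : (Z → ℕ → Pred Z 0ℓ) → Set
  Separating ball = ∀ {x y} → x ≢ y → ∃[ n ] Empty (ball x n ∩ ball y n)

  module _ {ball : Z → ℕ → Pred Z 0ℓ} where

    analytic-respects : ∀ {V W : Pred Z 0ℓ} → V ≐ W → Analytic ball V → Analytic ball W
    analytic-respects (V⊆W , W⊆V) (F , reg , V⊆F , F⊆V) = F , reg , V⊆F ∘ W⊆V , V⊆W ∘ F⊆V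

    analytic-∅ : Analytic ball ∅
    analytic-∅ = (λ _ → ∅) , (λ _ nonempty → contradiction (nonempty []) λ ()) , (λ ()) , λ ()

    -- The root of a code names a member of the family and its subtree at 0 codes a point of that
    -- member. Neighbourhoods prescribe the root too, so that nearby codes name the same member.
    analytic-⋃ : ∀ {V : ℕ → Pred Z 0ℓ} → (∀ n → Analytic ball (V n)) → Analytic ball (⋃ ℕ V)
    analytic-⋃ {V} anV = F , regular , V⊆F , F⊆V
      where
      Fₙ : ℕ → Code → Pred Z 0ℓ
      Fₙ n = proj₁ (anV n)

      F : Code → Pred Z 0ℓ
      F α = Fₙ (α []) (sub 0 α)

      near : ∀ α L → Near F α ([] ∷ map (0 ∷_) L) ⊆ Near (Fₙ (α [])) (sub 0 α) L
      near α L {z} (β , agree , z∈) = sub 0 β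
        , (λ l∈L → agree (there (∈-map⁺ (0 ∷_) l∈L)))
        , subst (λ n → z ∈ Fₙ n (sub 0 β)) (sym (agree (here refl))) z∈

      regular : Regular ball F
      regular α nonempty =
        let z , z∈ , conv = proj₁ (proj₂ (anV (α []))) (sub 0 α) (λ L →
                              let z , z∈ = nonempty ([] ∷ map (0 ∷_) L) in z , near α L z∈)
        in z , z∈ , λ n → let L , L⊆ = conv n in [] ∷ map (0 ∷_) L , λ z∈ → L⊆ (near α L z∈)

      V⊆F : ⋃ ℕ V ⊆ ⋃ Code F
      V⊆F (n , v) =
        let α , z∈ = proj₁ (proj₂ (proj₂ (anV n))) v
        in (λ { [] → n ; (_ ∷ l) → α l }) , z∈

      F⊆V : ⋃ Code F ⊆ ⋃ ℕ V
      F⊆V (α , z∈) = α [] , proj₂ (proj₂ (proj₂ (anV (α [])))) (sub 0 α , z∈)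

    -- Subtree n codes the point as an element of `V n`. The limits found for different n coincide:
    -- balls separating two of them would both contain the point of a single code close to `α`.
    analytic-⋂ : Separating ball →
      ∀ {V : ℕ → Pred Z 0ℓ} → (∀ n → Analytic ball (V n)) → Analytic ball (⋂ ℕ V)
    analytic-⋂ separating {V} anV = F , regular , V⊆F , F⊆V
      where
      Fₙ : ℕ → Code → Pred Z 0ℓ
      Fₙ n = proj₁ (anV n)

      F : Code → Pred Z 0ℓ
      F α z = ∀ n → z ∈ Fₙ n (sub n α)

      near : ∀ n α {L M} → map (n ∷_) L ⊆ˡ M → Near F α M ⊆ Near (Fₙ n) (sub n α) L
      near n α L⊆M (β , agree , z∈) = sub n β , (λ l∈L → agree (L⊆M (∈-map⁺ (n ∷_) l∈L))) , z∈ n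

      regular : Regular ball F
      regular α nonempty = z 0 , (λ n → subst (_∈ Fₙ n (sub n α)) (z≡ n) (z∈ n)) , λ k →
          map (0 ∷_) (proj₁ (conv 0 k)) , λ w∈ → proj₂ (conv 0 k) (near 0 α id w∈)
        where
        limit : ∀ n → ∃[ z ] z ∈ Fₙ n (sub n α) × (∀ k → ∃[ L ] Near (Fₙ n) (sub n α) L ⊆ ball z k)
        limit n = proj₁ (proj₂ (anV n)) (sub n α) λ L →
          let z , z∈ = nonempty (map (n ∷_) L) in z , near n α id z∈

        z : ℕ → Z
        z n = proj₁ (limit n)

        z∈ : ∀ n → z n ∈ Fₙ n (sub n α)
        z∈ n = proj₁ (proj₂ (limit n))

        conv : ∀ n k → ∃[ L ] Near (Fₙ n) (sub n α) L ⊆ ball (z n) k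
        conv n = proj₂ (proj₂ (limit n))

        z≡ : ∀ n → z n ≡ z 0
        z≡ n = dne λ z≢ →
          let k , disjoint = separating z≢
              L , L⊆ = conv n k
              M , M⊆ = conv 0 k
              w , w∈ = nonempty (map (n ∷_) L ++ map (0 ∷_) M)
          in disjoint w (L⊆ (near n α (∈-++⁺ˡ) w∈) , M⊆ (near 0 α (∈-++⁺ʳ (map (n ∷_) L)) w∈))

      V⊆F : ⋂ ℕ V ⊆ ⋃ Code F
      V⊆F v = (λ { [] → 0 ; (n ∷ l) → proj₁ (code n) l }) , λ n → proj₂ (code n)
        where code = λ n → proj₁ (proj₂ (proj₂ (anV n))) (v n)

      F⊆V : ⋃ Code F ⊆ ⋂ ℕ V
      F⊆V (α , z∈) n = proj₂ (proj₂ (proj₂ (anV n))) (sub n α , z∈ n)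

    analytic-∪ : ∀ {V W : Pred Z 0ℓ} → Analytic ball V → Analytic ball W → Analytic ball (V ∪ W)
    analytic-∪ {V} {W} anV anW = analytic-respects
      ((λ { (zero , v) → inj₁ v ; (suc _ , w) → inj₂ w }) , λ { (inj₁ v) → 0 , v ; (inj₂ w) → 1 , w })
      (analytic-⋃ {V = λ { zero → V ; (suc _) → W }} λ { zero → anV ; (suc _) → anW })

    analytic-∩ : Separating ball →
      ∀ {V W : Pred Z 0ℓ} → Analytic ball V → Analytic ball W → Analytic ball (V ∩ W)
    analytic-∩ separating {V} {W} anV anW = analytic-respects
      ((λ f → f 0 , f 1) , λ { (v , w) zero → v ; (v , w) (suc _) → w })
      (analytic-⋂ separating {V = λ { zero → V ; (suc _) → W }} λ { zero → anV ; (suc _) → anW })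

    -- Analytic sets need not have analytic complements, so the induction carries a set together
    -- with its complement.
    analytic-σ : ∀ {G : Pred (Pred Z 0ℓ) ℓ} → Separating ball → Analytic ball U →
      (∀ {V} → G V → Analytic ball V × Analytic ball (∁ V)) →
      ∀ {V} → σ⟨ G ⟩ V → Analytic ball V × Analytic ball (∁ V)
    analytic-σ separating anU anG = both
      where
      both : ∀ {V} → σ⟨ _ ⟩ V → Analytic ball V × Analytic ball (∁ V)
      both (generator g) = anG g
      both empty = analytic-∅ , analytic-respects ((λ _ ()) , λ _ → tt) anU
      both (complement σV) =
        let anV , an∁V = both σV in an∁V , analytic-respects ((λ v ¬v → ¬v v) , dne) anV
      both (union σV) = analytic-⋃ (proj₁ ∘ both ∘ σV) , analytic-respects
        ((λ ¬V (n , v) → ¬V n v) , λ ¬∃ n v → ¬∃ (n , v))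
        (analytic-⋂ separating (proj₂ ∘ both ∘ σV))
      both (respects (V⊆W , W⊆V) σV) =
        let anV , an∁V = both σV
        in analytic-respects (V⊆W , W⊆V) anV , analytic-respects ((_∘ W⊆V) , (_∘ V⊆W)) an∁V

  _⊗ᵇ_ : (Z₁ → ℕ → Pred Z₁ 0ℓ) → (Z₂ → ℕ → Pred Z₂ 0ℓ) → Z₁ × Z₂ → ℕ → Pred (Z₁ × Z₂) 0ℓ
  (ball₁ ⊗ᵇ ball₂) (x , y) n = ball₁ x n ⟨×⟩ ball₂ y n

  module _ {ball₁ : Z₁ → ℕ → Pred Z₁ 0ℓ} {ball₂ : Z₂ → ℕ → Pred Z₂ 0ℓ} where

    separating-⊗ : Separating ball₁ → Separating ball₂ → Separating (ball₁ ⊗ᵇ ball₂)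
    separating-⊗ sep₁ sep₂ {x₁ , x₂} {y₁ , y₂} x≢y with em {P = x₁ ≡ y₁}
    ... | no x₁≢y₁ = let n , disjoint = sep₁ x₁≢y₁
                     in n , λ { _ ((b , _) , (b′ , _)) → disjoint _ (b , b′) }
    ... | yes refl = let n , disjoint = sep₂ (x≢y ∘ cong (x₁ ,_))
                     in n , λ { _ ((_ , b) , (_ , b′)) → disjoint _ (b , b′) }

    -- The codes stay the same. Convergence takes place in the product, so the limit brings its own
    -- second coordinate as witness.
    analytic-proj₁ : ∀ {V : Pred (Z₁ × Z₂) 0ℓ} → Analytic (ball₁ ⊗ᵇ ball₂) V →
      Analytic ball₁ (λ x → ∃[ y ] (x , y) ∈ V)
    analytic-proj₁ {V} (F , regular , V⊆F , F⊆V) =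
        (λ α x → ∃[ y ] (x , y) ∈ F α)
      , (λ α nonempty →
          let (x , y) , xy∈ , conv = regular α λ L →
                let x , β , agree , y , xy∈ = nonempty L in (x , y) , β , agree , xy∈
          in x , (y , xy∈) , λ n →
               let L , L⊆ = conv n
               in L , λ (β , agree , y , xy∈) → proj₁ (L⊆ (β , agree , xy∈)))
      , (λ (y , v) → let α , xy∈ = V⊆F v in α , y , xy∈)
      , (λ (α , y , xy∈) → y , F⊆V (α , xy∈))

    analytic-× : ∀ {V : Pred Z₁ 0ℓ} {W : Pred Z₂ 0ℓ} → Analytic ball₁ V → Analytic ball₂ W →
      Analytic (ball₁ ⊗ᵇ ball₂) (V ⟨×⟩ W)
    analytic-× {V} {W} (F₁ , regular₁ , V⊆F₁ , F₁⊆V) (F₂ , regular₂ , W⊆F₂ , F₂⊆W) =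
      F , regular , V×W⊆F , λ (α , x∈ , y∈) → F₁⊆V (sub 0 α , x∈) , F₂⊆W (sub 1 α , y∈)
      where
      F : Code → Pred (Z₁ × Z₂) 0ℓ
      F α = F₁ (sub 0 α) ⟨×⟩ F₂ (sub 1 α)

      regular : Regular (ball₁ ⊗ᵇ ball₂) F
      regular α nonempty =
        let x , x∈ , conv₁ = regular₁ (sub 0 α) λ L →
              let (x , _) , β , agree , x∈ , _ = nonempty (map (0 ∷_) L)
              in x , sub 0 β , (λ l∈ → agree (∈-map⁺ (0 ∷_) l∈)) , x∈
            y , y∈ , conv₂ = regular₂ (sub 1 α) λ L →
              let (_ , y) , β , agree , _ , y∈ = nonempty (map (1 ∷_) L)
              in y , sub 1 β , (λ l∈ → agree (∈-map⁺ (1 ∷_) l∈)) , y∈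
        in (x , y) , (x∈ , y∈) , λ n →
          let L , L⊆ = conv₁ n
              M , M⊆ = conv₂ n
          in map (0 ∷_) L ++ map (1 ∷_) M , λ (β , agree , x∈ , y∈) →
               L⊆ (sub 0 β , (λ l∈ → agree (∈-++⁺ˡ (∈-map⁺ (0 ∷_) l∈))) , x∈)
             , M⊆ (sub 1 β , (λ l∈ → agree (∈-++⁺ʳ (map (0 ∷_) L) (∈-map⁺ (1 ∷_) l∈))) , y∈)

      V×W⊆F : (V ⟨×⟩ W) ⊆ ⋃ Code F
      V×W⊆F (v , w) =
        let α , x∈ = V⊆F₁ v
            β , y∈ = W⊆F₂ w
        in (λ { [] → 0 ; (zero ∷ l) → α l ; (suc _ ∷ l) → β l }) , x∈ , y∈

  -- Novikov separation

  module _ {ball : Z → ℕ → Pred Z 0ℓ} {G : Pred (Pred Z 0ℓ) ℓ}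
           (separating : Separating ball) (σ-ball : ∀ z n → σ⟨ G ⟩ (ball z n)) where

    Separated : (ℕ → Pred Z 0ℓ) → Set _
    Separated V = Σ[ B ∈ (ℕ → Pred Z 0ℓ) ]
      (∀ n → σ⟨ G ⟩ (B n)) × (∀ n → V n ⊆ B n) × Empty (⋂ ℕ B)

    -- If the Vₙ cannot be separated, then the codes of points of the Vₙ can be
    -- restricted, one value of one code at a time, so that the restrictions
    -- still cannot be separated. In the limit one code remains for each n. The
    -- points they code are all equal, since balls around two distinct ones
    -- would separate some stage; so they give a point of ⋂ Vₙ.
    novikov : ∀ {V : ℕ → Pred Z 0ℓ} → (∀ n → Analytic ball (V n)) → Empty (⋂ ℕ V) → Separated V
    novikov {V} anV empty-⋂V = dne λ ¬sepV →
      Limit.absurd λ (B , σB , V⊆B , empty-⋂B) →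
        ¬sepV (B , σB , (λ n {_} v → let α , z∈ = V⊆F n v in V⊆B n (α , (λ ()) , z∈)) , empty-⋂B)
      where
      F : ℕ → Code → Pred Z 0ℓ
      F n = proj₁ (anV n)

      V⊆F : ∀ n → V n ⊆ ⋃ Code (F n)
      V⊆F n = proj₁ (proj₂ (proj₂ (anV n)))

      Constraints : Set
      Constraints = List ((ℕ × List ℕ) × ℕ)

      Satisfies : Constraints → ℕ → Code → Set
      Satisfies s n β = ∀ {l v} → ((n , l) , v) ∈ˡ s → β l ≡ v

      V[_] : Constraints → ℕ → Pred Z 0ℓ
      V[ s ] n z = ∃[ β ] Satisfies s n β × z ∈ F n β

      -- Glues the separations obtained for the values v at position l of code n. At index n the
      -- restricted sets cover `V[ s ] n`, so take the union over v; at other indices the constraint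
      -- has no effect, so take the intersection. A point in all the results picks one v at index n
      -- and contradicts the separation for that v.
      separated-step : ∀ c s → (∀ v → Separated V[ (c , v) ∷ s ]) → Separated V[ s ]
      separated-step (n , l) s sep = B , σB , V⊆B , empty-⋂B
        where
        Bᵥ : ℕ → ℕ → Pred Z 0ℓ
        Bᵥ v = proj₁ (sep v)

        σBᵥ : ∀ v m → σ⟨ G ⟩ (Bᵥ v m)
        σBᵥ v = proj₁ (proj₂ (sep v))

        V⊆Bᵥ : ∀ v m → V[ ((n , l) , v) ∷ s ] m ⊆ Bᵥ v m
        V⊆Bᵥ v = proj₁ (proj₂ (proj₂ (sep v)))

        B : ℕ → Pred Z 0ℓ
        B m z = (m ≡ n → ∃[ v ] z ∈ Bᵥ v m) × (m ≢ n → ∀ v → z ∈ Bᵥ v m)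

        σB : ∀ m → σ⟨ G ⟩ (B m)
        σB m = σ-∩ (σ-⇒ (σ-const (m ≡ n)) (union λ v → σBᵥ v m))
                   (σ-⇒ (σ-const (m ≢ n)) (σ-⋂ λ v → σBᵥ v m))

        V⊆B : ∀ m → V[ s ] m ⊆ B m
        V⊆B m (β , sat , z∈) =
            (λ { refl → β l , V⊆Bᵥ (β l) m (β , (λ { (here refl) → refl ; (there c∈) → sat c∈ }) , z∈) })
          , (λ m≢n v → V⊆Bᵥ v m (β , (λ { (here refl) → contradiction refl m≢n ; (there c∈) → sat c∈ }) , z∈))

        empty-⋂B : Empty (⋂ ℕ B)
        empty-⋂B z z∈ = proj₂ (proj₂ (proj₂ (sep v))) z all
          where
          v = proj₁ (proj₁ (z∈ n) refl)

          all : ∀ m → z ∈ Bᵥ v m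
          all m with m ℕ.≟ n
          ... | yes refl = proj₂ (proj₁ (z∈ n) refl)
          ... | no m≢n   = proj₂ (z∈ m) m≢n v

      module Limit (¬sep₀ : ¬ Separated V[ [] ]) where

        extend : ∀ c s → ¬ Separated V[ s ] → ∃[ v ] ¬ Separated V[ (c , v) ∷ s ]
        extend c s ¬sep = ¬∀⇒∃¬ (¬sep ∘ separated-step c s)

        state : ℕ → ∃[ s ] ¬ Separated V[ s ]
        value : ℕ → ℕ
        stage : ℕ → Constraints
        stage t = proj₁ (state t)
        value t = proj₁ (extend (enumerate t) (stage t) (proj₂ (state t)))
        state zero    = [] , ¬sep₀
        state (suc t) = (enumerate t , value t) ∷ stage t
          , proj₂ (extend (enumerate t) (stage t) (proj₂ (state t)))

        stage-mono : ∀ {t u} → t ℕ.≤′ u → stage t ⊆ˡ stage u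
        stage-mono ℕ.≤′-refl       c∈ = c∈
        stage-mono (ℕ.≤′-step t≤u) c∈ = there (stage-mono t≤u c∈)

        -- A position can be enumerated repeatedly. Any of its stages will do: contradictory values
        -- would leave some restriction empty, which `nonempty` excludes.
        α : ℕ → Code
        α n l = value (proj₁ (enumerate-surjective (n , l)))

        determined : ∀ n l → ∃[ t ] ((n , l) , α n l) ∈ˡ stage t
        determined n l = let t , eq = enumerate-surjective (n , l)
                         in suc t , here (cong (_, value t) (sym eq))

        determinedAll : ∀ n L → ∃[ t ] (∀ {l} → l ∈ˡ L → ((n , l) , α n l) ∈ˡ stage t)
        determinedAll n []      = 0 , λ ()
        determinedAll n (l ∷ L) =
          let t , l∈ = determined n l
              u , L⊆ = determinedAll n L
          in t ⊔ u , λ { (here refl) → stage-mono (ℕ.≤⇒≤′ (ℕ.m≤m⊔n t u)) l∈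
                       ; (there l∈L) → stage-mono (ℕ.≤⇒≤′ (ℕ.m≤n⊔m t u)) (L⊆ l∈L) }

        stage⊆Near : ∀ n L → ∃[ t ] (∀ {u} → t ≤ u → V[ stage u ] n ⊆ Near (F n) (α n) L)
        stage⊆Near n L =
          let t , L⊆ = determinedAll n L
          in t , λ t≤u (β , sat , z∈) →
               β , (λ l∈L → sym (sat (stage-mono (ℕ.≤⇒≤′ t≤u) (L⊆ l∈L)))) , z∈

        -- If one restriction were empty, sets that are each everything or nothing would already
        -- separate the stage.
        nonempty : ∀ t n → Satisfiable (V[ stage t ] n)
        nonempty t n = dne λ empty-V → proj₂ (state t)
          ( (λ m _ → Satisfiable (V[ stage t ] m))
          , (λ m → σ-const _)
          , (λ m {_} z∈ → _ , z∈)
          , (λ z z∈ → empty-V (z∈ n)) )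

        limit : ∀ n → ∃[ z ] z ∈ F n (α n) × (∀ k → ∃[ L ] Near (F n) (α n) L ⊆ ball z k)
        limit n = proj₁ (proj₂ (anV n)) (α n) λ L →
          let t , V⊆Near = stage⊆Near n L
              z , z∈     = nonempty t n
          in z , V⊆Near ℕ.≤-refl z∈

        z : ℕ → Z
        z n = proj₁ (limit n)

        z≡ : ∀ n → z n ≡ z 0
        z≡ n = dne λ z≢ →
          let k , disjoint = separating z≢
              L , L⊆       = proj₂ (proj₂ (limit n)) k
              M , M⊆       = proj₂ (proj₂ (limit 0)) k
              t , V⊆L      = stage⊆Near n L
              u , V⊆M      = stage⊆Near 0 M
          in proj₂ (state (t ⊔ u))
            -- One ball at index n, the other at index 0, and the whole space at all further
            -- indices.
            ( (λ m w → (m ≡ n → w ∈ ball (z n) k) × (m ≡ 0 → w ∈ ball (z 0) k))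
            , (λ m → σ-∩ (σ-⇒ (σ-const (m ≡ n)) (σ-ball (z n) k))
                         (σ-⇒ (σ-const (m ≡ 0)) (σ-ball (z 0) k)))
            , (λ m {_} w∈ → (λ { refl → L⊆ (V⊆L (ℕ.m≤m⊔n t u) w∈) })
                      , (λ { refl → M⊆ (V⊆M (ℕ.m≤n⊔m t u) w∈) }))
            , (λ w w∈ → disjoint w (proj₁ (w∈ n) refl , proj₂ (w∈ 0) refl)) )

        absurd : ∀ {P : Set} → P
        absurd = ⊥-elim (empty-⋂V (z 0) λ n → proj₂ (proj₂ (proj₂ (anV n)))
          (α n , subst (_∈ F n (α n)) (z≡ n) (proj₁ (proj₂ (limit n)))))

    abstract
      -- Novikov separation of the sequence V, W, W, ...: a point of `W` in `B 0` would lie in every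
      -- `B n`.
      suslin : ∀ {V W : Pred Z 0ℓ} → Analytic ball V → Analytic ball W → Empty (V ∩ W) →
        Σ[ B ∈ Pred Z 0ℓ ] σ⟨ G ⟩ B × V ⊆ B × Empty (W ∩ B)
      suslin {V} {W} anV anW disjoint =
        let B , σB , VW⊆B , empty-⋂B = novikov
              {V = λ { zero → V ; (suc _) → W }} (λ { zero → anV ; (suc _) → anW })
              (λ z z∈ → disjoint z (z∈ 0 , z∈ 1))
        in B 0 , σB 0 , VW⊆B 0 , λ z (w , b) → empty-⋂B z λ { zero → b ; (suc n) → VW⊆B (suc n) w }

  -- Polish spaces

  module Polish (M : PolishMetric Z) where
    open PolishMetric M
    open IsGeneralMetric isMetric using (triangle; ≈⇒0; 0⇒≈) renaming (sym to d-sym)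
    open ℝ≥0

    private
      variable
        x y w : Z
        p q : ℚ

    <-sym : d x y <ᴿ q → d y x <ᴿ q
    <-sym {x} {y} = proj₁ (d-sym x y)

    <-triangle : d x y <ᴿ p → d y w <ᴿ q → d x w <ᴿ p ℚ.+ q
    <-triangle {x} {y} {p} {w} {q} xy yw = triangle x y w (p , q , xy , yw , ℚ.≤-refl)

    <-weaken : d x y <ᴿ p → p ℚ.≤ q → d x y <ᴿ q
    <-weaken {x} {y} = upward (d x y)

    <-refl : 0ℚ ℚ.< q → d x x <ᴿ q
    <-refl 0<q = proj₂ (≈⇒0 refl) 0<q

    close⇒≡ : (∀ q → 0ℚ ℚ.< q → d x y <ᴿ q) → x ≡ y
    close⇒≡ {x} {y} close = 0⇒≈ ((λ q∈ → positive (d x y) q∈) , λ 0<q → close _ 0<q)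

    ≢⇒apart : x ≢ y → ∃[ ε ] 0ℚ ℚ.< ε × ¬ d x y <ᴿ ε
    ≢⇒apart x≢y =
      let ε , ¬close = ¬∀⇒∃¬ (x≢y ∘ close⇒≡)
          0<ε , ¬lt  = ¬∀⇒∃¬ ¬close
      in ε , 0<ε , ¬lt

    small : ∀ ε → 0ℚ ℚ.< ε → ∃[ n ] radius n ℚ.< ε
    small ε 0<ε = let N , lt = radius-null ε 0<ε in N , lt N ℕ.≤-refl

    ball : Z → ℕ → Pred Z 0ℓ
    ball x n y = d x y <ᴿ radius n

    ball-separating : Separating ball
    ball-separating x≢y =
      let ε , 0<ε , apart = ≢⇒apart x≢y
          n , r<          = small (half ε) (half-positive 0<ε)
      in n , λ z (xz , yz) → apart (subst (d _ _ <ᴿ_) (half+half ε)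
               (<-triangle (<-weaken xz (ℚ.<⇒≤ r<)) (<-sym (<-weaken yz (ℚ.<⇒≤ r<)))))

    open-ball : ∀ x q → Open (λ y → d x y <ᴿ q)
    open-ball x q y xy =
      let p , xy<p , p<q = rounded (d x y) xy
          δ , 0<δ , δ+p≡q = gap p<q
      in δ , 0<δ , λ z yz → subst (d x z <ᴿ_) (trans (ℚ.+-comm p δ) δ+p≡q) (<-triangle xy<p yz)

    σ-ball : ∀ x n → σ⟨ Open ⟩ (ball x n)
    σ-ball x n = generator (open-ball x (radius n))

    e : ℕ → _
    e = proj₁ separable

    -- Closed balls, because the condition has to pass to limits.
    Approx : ℕ → ℕ → Pred Z 0ℓ
    Approx i n x = ∃[ y ] e i ≡ just y × (∀ q → radius n ℚ.< q → d x y <ᴿ q)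

    -- At position `n ∷ []` a code holds the index of a dense point within `radius n`. If all
    -- neighbourhoods are inhabited, any two of these centres are close to a common point, hence the
    -- centres are Cauchy; the limit is in `D` since points of `D` come arbitrarily close to it.
    analytic-closed : ∀ {D} → Open (∁ D) → Analytic ball D
    analytic-closed {D} open-∁D = F , regular , D⊆F , λ (α , x∈D , _) → x∈D
      where
      F : Code → Pred Z 0ℓ
      F α x = x ∈ D × (∀ n → Approx (α (n ∷ [])) n x)

      D⊆F : D ⊆ ⋃ Code F
      D⊆F {x} x∈D = (λ { [] → 0 ; (n ∷ _) → proj₁ (near n) }) , x∈D , λ n →
          let _ , y , eq , xy = near n in y , eq , λ q r<q → <-weaken xy (ℚ.<⇒≤ r<q)
        where near = λ n → proj₂ separable x (radius n) (radius-positive n)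

      regular : Regular ball F
      regular α nonempty = z , (z∈D , λ n → center n , center≡ n , approx n) , λ n →
          let N , ⊆ball = converges (radius n) (radius-positive n)
          in (N ∷ []) ∷ [] , λ w∈ → ⊆ball (within w∈ (here refl))
        where
        center : ℕ → Z
        center n = let _ , _ , _ , _ , approx = nonempty ((n ∷ []) ∷ []) in proj₁ (approx n)

        center≡ : ∀ n → e (α (n ∷ [])) ≡ just (center n)
        center≡ n = let _ , _ , agree , _ , approx = nonempty ((n ∷ []) ∷ [])
                    in trans (cong e (agree (here refl))) (proj₁ (proj₂ (approx n)))

        within : ∀ {x L n} → Near F α L x → (n ∷ []) ∈ˡ L → ∀ {q} → radius n ℚ.< q → d x (center n) <ᴿ q
        within {n = n} (β , agree , _ , approx) n∈L r<q =
          let y , eq , xy = approx n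
              y≡ = just-injective (trans (sym eq) (trans (cong e (sym (agree n∈L))) (center≡ n)))
          in subst (λ y → d _ y <ᴿ _) y≡ (xy _ r<q)

        cauchy : Cauchy center
        cauchy ε 0<ε =
          let N , r< = radius-null (half ε) (half-positive 0<ε)
          in N , λ m n N≤m N≤n →
            let x , x∈ = nonempty ((m ∷ []) ∷ (n ∷ []) ∷ [])
            in subst (d _ _ <ᴿ_) (half+half ε)
                 (<-triangle (<-sym (within x∈ (here refl) (r< m N≤m)))
                             (within x∈ (there (here refl)) (r< n N≤n)))

        z = proj₁ (complete center cauchy)

        converges : ∀ ε → 0ℚ ℚ.< ε → ∃[ n ] (∀ {x} →
          (∀ {q} → radius n ℚ.< q → d x (center n) <ᴿ q) → d z x <ᴿ ε)
        converges ε 0<ε =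
          let N , r<  = radius-null (half ε) (half-positive 0<ε)
              N′ , c< = proj₂ (complete center cauchy) (half ε) (half-positive 0<ε)
              n = N ⊔ N′
          in n , λ xc → subst (d z _ <ᴿ_) (half+half ε)
               (<-triangle (<-sym (c< n (ℕ.m≤n⊔m N N′))) (<-sym (xc (r< n (ℕ.m≤m⊔n N N′)))))

        z∈D : z ∈ D
        z∈D = dne λ z∉D →
          let ε , 0<ε , ⊆∁D = open-∁D z z∉D
              n , close      = converges ε 0<ε
              x , x∈         = nonempty ((n ∷ []) ∷ [])
              _ , _ , x∈D , _ = x∈
          in ⊆∁D x (close (within x∈ (here refl))) x∈D

        approx : ∀ n q → radius n ℚ.< q → d z (center n) <ᴿ q
        approx n q r<q =
          let p , r<p , p<q   = ℚ.<-dense r<q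
              δ , 0<δ , δ+p≡q = gap p<q
              m , close       = converges δ 0<δ
              x , x∈          = nonempty ((m ∷ []) ∷ (n ∷ []) ∷ [])
          in subst (d z _ <ᴿ_) δ+p≡q
               (<-triangle (close (within x∈ (here refl))) (within x∈ (there (here refl)) r<p))

    analytic-U : Analytic ball U
    analytic-U = analytic-closed λ x x∉U → contradiction tt x∉U

    -- Exhausts `V` by the closed sets of points whose distance to the complement is at least
    -- `radius n`.
    analytic-open : ∀ {V} → Open V → Analytic ball V
    analytic-open {V} openV = analytic-respects
      ( (λ (n , inside) → inside _ (<-refl (radius-positive n)))
      , (λ v → let ε , 0<ε , ⊆V = openV _ v
                   n , r<ε      = small ε 0<ε
               in n , λ y xy → ⊆V y (<-weaken xy (ℚ.<⇒≤ r<ε))) )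
      (analytic-⋃ λ n → analytic-closed {Inside n} λ x ¬inside →
        let y , ¬y       = ¬∀⇒∃¬ ¬inside
            xy , y∉V     = ¬∀⇒∃¬ ¬y
            p , xy<p , p<r = rounded (d x y) xy
            δ , 0<δ , δ+p≡r = gap p<r
        in δ , 0<δ , λ x′ xx′ inside → y∉V (inside y
             (subst (d x′ y <ᴿ_) δ+p≡r (<-triangle (<-sym xx′) xy<p))))
      where
      Inside : ℕ → Pred Z 0ℓ
      Inside n x = ∀ y → d x y <ᴿ radius n → y ∈ V

    borel⇒analytic : ∀ {V} → σ⟨ Open ⟩ V → Analytic ball V × Analytic ball (∁ V)
    borel⇒analytic = analytic-σ ball-separating analytic-U λ openV →
      analytic-open openV , analytic-closed λ x x∉ →
        let ε , 0<ε , ⊆V = openV x (dne x∉) in ε , 0<ε , λ y xy y∉ → y∉ (⊆V y xy)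

  -- Borel relations with finite sections

  module FiniteSections (𝕏 : StandardBorelSpace) where
    open StandardBorelSpace 𝕏 renaming (Carrier to X)
    open PolishMetric polishMetric
    open Polish polishMetric

    𝓑 : Pred (Pred X 0ℓ) _
    𝓑 = σ⟨ Open ⟩

    toσ : ∀ {V} → Borel V → 𝓑 V
    toσ {V} = Equivalence.to (Borel⇔σ⟨Open⟩ V)

    fromσ : ∀ {V} → 𝓑 V → Borel V
    fromσ {V} = Equivalence.from (Borel⇔σ⟨Open⟩ V)

    ball² : X × X → ℕ → Pred (X × X) 0ℓ
    ball² = ball ⊗ᵇ ball

    ball²-separating : Separating ball²
    ball²-separating = separating-⊗ ball-separating ball-separating

    𝓑² : Pred (Pred (X × X) 0ℓ) _
    𝓑² = σ⟨ Rectangle ⟩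

    rectangle : ∀ {V W} → 𝓑 V → 𝓑 W → 𝓑² (V ⟨×⟩ W)
    rectangle bV bW = generator (fromσ bV ⊗ fromσ bW)

    borel-proj₁⁻¹ : ∀ {V} → 𝓑 V → 𝓑² (V ∘ proj₁)
    borel-proj₁⁻¹ bV = respects (proj₁ , (_, tt)) (rectangle bV (σ-const ⊤))

    borel-proj₂⁻¹ : ∀ {V} → 𝓑 V → 𝓑² (V ∘ proj₂)
    borel-proj₂⁻¹ bV = respects (proj₂ , (tt ,_)) (rectangle (σ-const ⊤) bV)

    borel-ball² : ∀ p n → 𝓑² (ball² p n)
    borel-ball² (x , y) n = rectangle (σ-ball x n) (σ-ball y n)

    analytic-proj₁⁻¹ : ∀ {V} → Analytic ball V → Analytic ball² (V ∘ proj₁)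
    analytic-proj₁⁻¹ anV = analytic-respects (proj₁ , (_, tt)) (analytic-× anV analytic-U)

    analytic-proj₂⁻¹ : ∀ {V} → Analytic ball V → Analytic ball² (V ∘ proj₂)
    analytic-proj₂⁻¹ anV = analytic-respects (proj₂ , (tt ,_)) (analytic-× analytic-U anV)

    borelRel⇒analytic : ∀ {R} → 𝓑² R → Analytic ball² R × Analytic ball² (∁ R)
    borelRel⇒analytic = analytic-σ ball²-separating (analytic-proj₁⁻¹ analytic-U) rect
      where
      rect : ∀ {R} → Rectangle R → Analytic ball² R × Analytic ball² (∁ R)
      rect (_⊗_ {V} {W} bV bW) =
        let anV , an∁V = borel⇒analytic (toσ bV)
            anW , an∁W = borel⇒analytic (toσ bW)
        in analytic-× anV anW
         , analytic-respects ([ (λ ¬v → ¬v ∘ proj₁) , (λ ¬w → ¬w ∘ proj₂) ]′ , decide)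
             (analytic-∪ (analytic-proj₁⁻¹ an∁V) (analytic-proj₂⁻¹ an∁W))
        where
        decide : ∀ {p} → ¬ (V ⟨×⟩ W) p → p ∈ (∁ V ∘ proj₁) ∪ (∁ W ∘ proj₂)
        decide {x , y} ¬vw with em {P = x ∈ V}
        ... | yes v = inj₂ λ w → ¬vw (v , w)
        ... | no ¬v = inj₁ ¬v

    Dom : Pred (X × X) 0ℓ → Pred X 0ℓ
    Dom R x = ∃[ y ] (x , y) ∈ R

    analytic-Dom : ∀ {R} → 𝓑² R → Analytic ball (Dom R)
    analytic-Dom bR = analytic-proj₁ (proj₁ (borelRel⇒analytic bR))

    -- Indexed by the position in the dense enumeration, which makes the family countable for
    -- rational radii; empty where the enumeration skips.
    Cell : ℕ → ℚ → Pred X 0ℓ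
    Cell i q y = ∃[ c ] e i ≡ just c × d c y <ᴿ q

    borel-Cell : ∀ i q → 𝓑 (Cell i q)
    borel-Cell i q = generator λ y (c , eq , cy) →
      let δ , 0<δ , ⊆ball = open-ball c q y cy in δ , 0<δ , λ z yz → c , eq , ⊆ball z yz

    Cell-cover : ∀ y n → ∃[ i ] y ∈ Cell i (radius n)
    Cell-cover y n = let i , c , eq , yc = proj₂ separable y (radius n) (radius-positive n)
                     in i , c , eq , <-sym yc

    -- Two radii are allowed because `G-extends` compares a cell with the concentric one of twice
    -- the radius.
    Cell-diameter : ∀ {i p q y z} → y ∈ Cell i p → z ∈ Cell i q → d y z <ᴿ p ℚ.+ q
    Cell-diameter {q = q} (c , eq , cy) (c′ , eq′ , cz) = <-triangle (<-sym cy)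
      (subst (λ c → d c _ <ᴿ q) (just-injective (trans (sym eq′) eq)) cz)

    basic : ℕ → Pred X 0ℓ
    basic j = let i , n = unpair j in Cell i (radius n)

    basic-around : ∀ y ε → 0ℚ ℚ.< ε → ∃[ j ] y ∈ basic j × (∀ {z} → z ∈ basic j → d y z <ᴿ ε)
    basic-around y ε 0<ε =
      let n , r< = small (half ε) (half-positive 0<ε)
          i , y∈ = Cell-cover y n
          j , eq = unpair-surjective (i , n)
          cell = λ ((i , n) : ℕ × ℕ) → Cell i (radius n)
      in j , subst (λ p → y ∈ cell p) (sym eq) y∈ , λ {z} z∈ →
           subst (d y z <ᴿ_) (half+half ε) (<-weaken
             (Cell-diameter y∈ (subst (λ p → z ∈ cell p) eq z∈))
             (ℚ.+-mono-≤ (ℚ.<⇒≤ r<) (ℚ.<⇒≤ r<)))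

    -- Domains of Borel partial functions

    Functional : Pred (X × X) 0ℓ → Set
    Functional R = ∀ {x y z} → (x , y) ∈ R → (x , z) ∈ R → y ≡ z

    -- Lusin–Souslin. The preimages C i n of the cells under the partial function
    -- R are separated from those of their complements; they determine a point
    -- up to 2 · radius n for all n, hence define an extension G of R whose domain
    -- D is Borel. So Dom R and D ∖ Dom R are both analytic.
    module _ {R : Pred (X × X) 0ℓ} (bR : 𝓑² R) (functional : Functional R) where
      private
        separation : ∀ i n → Σ[ B ∈ Pred X 0ℓ ] 𝓑 B
          × Dom (R ∩ (Cell i (radius n) ∘ proj₂)) ⊆ B
          × Empty (Dom (R ∩ (∁ (Cell i (radius n)) ∘ proj₂)) ∩ B)
        separation i n = suslin ball-separating σ-ball
          (analytic-Dom (σ-∩ bR (borel-proj₂⁻¹ (borel-Cell i (radius n)))))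
          (analytic-Dom (σ-∩ bR (borel-proj₂⁻¹ (complement (borel-Cell i (radius n))))))
          λ { x ((y , xy , v) , (z , xz , ¬v)) →
              ¬v (subst (_∈ Cell i (radius n)) (functional xy xz) v) }

        C : ℕ → ℕ → Pred X 0ℓ
        C i n = proj₁ (separation i n)

        borel-C : ∀ i n → 𝓑 (C i n)
        borel-C i n = proj₁ (proj₂ (separation i n))

        Cell⇒C : ∀ {i n x y} → (x , y) ∈ R → y ∈ Cell i (radius n) → x ∈ C i n
        Cell⇒C {i} {n} xy v = proj₁ (proj₂ (proj₂ (separation i n))) (_ , xy , v)

        C⇒Cell : ∀ {i n x y} → (x , y) ∈ R → x ∈ C i n → y ∈ Cell i (radius n)
        C⇒Cell {i} {n} xy c = dne λ ¬v → proj₂ (proj₂ (proj₂ (separation i n))) _ ((_ , xy , ¬v) , c)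

        Overlap : ℕ → ℕ → ℕ → ℕ → Set
        Overlap i n j m = Satisfiable (Cell i (radius n) ∩ Cell j (radius m))

        -- Just what makes the centres of the cells assigned to x a Cauchy sequence, in countably
        -- many conditions on membership in the Borel sets `C i n`.
        D : Pred X 0ℓ
        D x = (∀ n → ∃[ i ] x ∈ C i n) × (∀ i n j m → x ∈ C i n → x ∈ C j m → Overlap i n j m)

        borel-D : 𝓑 D
        borel-D = σ-∩ (σ-⋂ λ n → union λ i → borel-C i n)
          (σ-⋂ λ i → σ-⋂ λ n → σ-⋂ λ j → σ-⋂ λ m →
            σ-⇒ (borel-C i n) (σ-⇒ (borel-C j m) (σ-const (Overlap i n j m))))

        Dom⊆D : Dom R ⊆ D
        Dom⊆D (y , xy) = (λ n → let i , v = Cell-cover y n in i , Cell⇒C xy v)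
          , λ i n j m c c′ → y , C⇒Cell xy c , C⇒Cell xy c′

        -- The radius is doubled because the limit of centres whose cells meet a given cell may fall
        -- outside that cell.
        G : Pred (X × X) 0ℓ
        G (x , y) = ∀ i n → x ∈ C i n → y ∈ Cell i (radius n ℚ.+ radius n)

        borel-G : 𝓑² G
        borel-G = σ-⋂ λ i → σ-⋂ λ n →
          σ-⇒ (borel-proj₁⁻¹ (borel-C i n)) (borel-proj₂⁻¹ (borel-Cell i (radius n ℚ.+ radius n)))

        D⊆DomG : D ⊆ Dom G
        D⊆DomG {x} (total , meets) = z , inCell
          where
          index : ℕ → ℕ
          index n = proj₁ (total n)

          center : ℕ → X
          center n = let _ , (c , _) , _ = meets _ n _ n (proj₂ (total n)) (proj₂ (total n)) in c

          center≡ : ∀ n → e (index n) ≡ just (center n)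
          center≡ n = let _ , (_ , eq , _) , _ = meets _ n _ n (proj₂ (total n)) (proj₂ (total n)) in eq

          near : ∀ {i n c} → x ∈ C i n → e i ≡ just c → ∀ m → d c (center m) <ᴿ radius n ℚ.+ radius m
          near {i} {n} x∈ eq m =
            let w , (c , eq′ , cw) , (c′ , eq″ , c′w) = meets i n (index m) m x∈ (proj₂ (total m))
            in subst₂ (λ c c′ → d c c′ <ᴿ radius n ℚ.+ radius m)
                 (just-injective (trans (sym eq′) eq))
                 (just-injective (trans (sym eq″) (center≡ m)))
                 (<-triangle cw (<-sym c′w))

          limit : ∃ (ConvergesTo center)
          limit = complete center λ ε 0<ε →
            let N , r< = radius-null (half ε) (half-positive 0<ε)
            in N , λ m n N≤m N≤n → subst (d _ _ <ᴿ_) (half+half ε)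
                 (<-weaken (near (proj₂ (total m)) (center≡ m) n)
                   (ℚ.+-mono-≤ (ℚ.<⇒≤ (r< m N≤m)) (ℚ.<⇒≤ (r< n N≤n))))

          z = proj₁ limit

          inCell : (x , z) ∈ G
          inCell i n x∈ =
            let _ , (c , eq , _) , _ = meets i n i n x∈ x∈
                r = radius n
                0<r/2 = half-positive (radius-positive n)
                N , r<  = radius-null (half r) 0<r/2
                N′ , c< = proj₂ limit (half r) 0<r/2
                m = N ⊔ N′
            in c , eq , subst (d c z <ᴿ_)
                 (trans (ℚ.+-assoc r (half r) (half r)) (cong (r ℚ.+_) (half+half r)))
                 (<-triangle
                   (<-weaken (near x∈ eq m) (ℚ.+-monoʳ-≤ r (ℚ.<⇒≤ (r< m (ℕ.m≤m⊔n N N′)))))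
                   (c< m (ℕ.m≤n⊔m N N′)))

        G-extends : ∀ {x y z} → (x , y) ∈ R → (x , z) ∈ G → y ≡ z
        G-extends {x} {y} {z} xy xz = close⇒≡ λ q 0<q →
          let q/2 = half q
              0<q/2 = half-positive 0<q
              -- With `radius n` below q/4, both `radius n` and its double are at most q/2.
              n , r< = small (half q/2) (half-positive 0<q/2)
              r≤ = ℚ.<⇒≤ r<
              i , v = Cell-cover y n
              r+r≤ = subst (radius n ℚ.+ radius n ℚ.≤_) (half+half q/2) (ℚ.+-mono-≤ r≤ r≤)
          in subst (d y z <ᴿ_) (half+half q) (<-weaken
               (Cell-diameter v (xz i n (Cell⇒C xy v)))
               (ℚ.+-mono-≤ (ℚ.≤-trans r≤ (half≤ 0<q/2)) r+r≤))

        final : Σ[ B ∈ Pred X 0ℓ ] 𝓑 B × Dom R ⊆ B × Empty (Dom (G ∩ ∁ R) ∩ B)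
        final = suslin ball-separating σ-ball (analytic-Dom bR)
          (analytic-Dom (σ-∩ borel-G (complement bR)))
          λ { x ((y , xy) , (z , g , ¬xz)) → ¬xz (subst (λ y → (x , y) ∈ R) (G-extends xy g) xy) }

      borel-Dom : 𝓑 (Dom R)
      borel-Dom = respects (D∩B⊆Dom , λ {x} xR → Dom⊆D {x} xR , Dom⊆B {x} xR) (σ-∩ borel-D borel-B)
        where
        B : Pred X 0ℓ
        B = proj₁ final

        borel-B : 𝓑 B
        borel-B = proj₁ (proj₂ final)

        Dom⊆B : Dom R ⊆ B
        Dom⊆B = proj₁ (proj₂ (proj₂ final))

        D∩B⊆Dom : D ∩ B ⊆ Dom R
        D∩B⊆Dom {x} (d , b) =
          let y , g = D⊆DomG {x} d
          in y , dne λ ¬xy → proj₂ (proj₂ (proj₂ final)) x ((y , g , ¬xy) , b)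

    -- Composition with Borel relations that have finite sections

    infixr 9 _⨾_
    _⨾_ : Pred (X × X) 0ℓ → Pred (X × X) 0ℓ → Pred (X × X) 0ℓ
    (R ⨾ S) (x , z) = ∃[ y ] (x , y) ∈ R × (y , z) ∈ S

    -- Induction on the construction of `S`. A rectangle V × W reduces to the domain of R restricted
    -- to values in V. For complements, single-valuedness turns `R ⨾ ∁ S` into `Dom R` minus
    -- `R ⨾ S`.
    borel-functional-⨾ : ∀ {R S} → 𝓑² R → Functional R → 𝓑² S → 𝓑² (R ⨾ S)
    borel-functional-⨾ {R} bR functional = compose
      where
      compose : ∀ {S} → 𝓑² S → 𝓑² (R ⨾ S)
      compose (generator (bV ⊗ bW)) = respects
        ((λ ((y , xy , v) , w) → y , xy , v , w) , λ (y , xy , v , w) → (y , xy , v) , w)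
        (rectangle (borel-Dom (σ-∩ bR (borel-proj₂⁻¹ (toσ bV)))
                              λ (xy , _) (xz , _) → functional xy xz)
                   (toσ bW))
      compose empty = respects ((λ ()) , λ ()) empty
      compose (complement {S} bS) = respects
        ( (λ ((y , xy) , ¬S) → y , xy , λ s → ¬S (y , xy , s))
        , (λ (y , xy , ¬s) → (y , xy) , λ (z , xz , s) →
             ¬s (subst (λ y → (y , _) ∈ S) (functional xz xy) s)) )
        (σ-∩ (borel-proj₁⁻¹ (borel-Dom bR functional)) (complement (compose bS)))
      compose (union bS) = respects
        ((λ (n , y , xy , s) → y , xy , n , s) , λ (y , xy , n , s) → n , y , xy , s)
        (union (compose ∘ bS))
      compose (respects (S⊆S′ , S′⊆S) bS) = respects
        ((λ (y , xy , s) → y , xy , S⊆S′ s) , λ (y , xy , s) → y , xy , S′⊆S s) (compose bS)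

    FiniteSections : Pred (X × X) 0ℓ → Set
    FiniteSections R = ∀ x → ∃[ ys ] (∀ {y} → (x , y) ∈ R → y ∈ˡ ys)

    isolated : ∀ y (ys : List X) → ∃[ ε ] 0ℚ ℚ.< ε × (∀ {z} → z ∈ˡ ys → d y z <ᴿ ε → y ≡ z)
    isolated y []       = 1ℚ , ℚ.positive⁻¹ 1ℚ , λ ()
    isolated y (x ∷ ys) with em {P = y ≡ x} | isolated y ys
    ... | yes y≡x | ε , 0<ε , iso = ε , 0<ε , λ { (here refl) _ → y≡x ; (there z∈) → iso z∈ }
    ... | no y≢x  | ε , 0<ε , iso =
      let δ , 0<δ , apart = ≢⇒apart y≢x
      in δ ℚ.⊓ ε , ⊓-positive 0<δ 0<ε
       , λ { (here refl) yx → contradiction (<-weaken yx (ℚ.p⊓q≤p δ ε)) apart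
           ; (there z∈) yz → iso z∈ (<-weaken yz (ℚ.p⊓q≤q δ ε)) }
      where
      ⊓-positive : ∀ {p q} → 0ℚ ℚ.< p → 0ℚ ℚ.< q → 0ℚ ℚ.< p ℚ.⊓ q
      ⊓-positive {p} {q} 0<p 0<q with ℚ.⊓-sel p q
      ... | inj₁ eq = subst (0ℚ ℚ.<_) (sym eq) 0<p
      ... | inj₂ eq = subst (0ℚ ℚ.<_) (sym eq) 0<q

    -- Lusin–Novikov for finite sections. The analytic sets A j of those
    -- (x , y) ∈ R for which basic j does not isolate y in the section of x have
    -- empty intersection; off a Borel superset of A j the relation is functional.
    abstract
      functional-pieces : ∀ {R} → 𝓑² R → FiniteSections R →
        Σ[ S ∈ (ℕ → Pred (X × X) 0ℓ) ] (∀ j → 𝓑² (S j)) × (∀ j → Functional (S j)) × R ≐ ⋃ ℕ S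
      functional-pieces {R} bR finite =
        let B , bB , A⊆B , empty-⋂B = novikov ball²-separating borel-ball² analytic-A empty-⋂A
        in (λ j → R ∩ ∁ (B j))
         , (λ j → σ-∩ bR (complement (bB j)))
         , (λ j (xy , ¬b) (xz , ¬b′) → isolates {j} (¬b ∘ A⊆B j) (¬b′ ∘ A⊆B j) xy xz)
         , (λ xy → let j , ¬b = ¬∀⇒∃¬ (empty-⋂B _) in j , xy , ¬b)
         , λ (j , xy , _) → xy
        where
        -- `basic l` tells y apart from another point of the section inside `basic j`. Phrased as
        -- one condition on y and one on x, so it is a product of analytic sets.
        Splits : ℕ → ℕ → Pred (X × X) 0ℓ
        Splits j l (x , y) = y ∈ basic l × x ∈ Dom (R ∩ ((basic j ∩ ∁ (basic l)) ∘ proj₂))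

        A : ℕ → Pred (X × X) 0ℓ
        A j = R ∩ ((∁ (basic j) ∘ proj₂) ∪ ⋃ ℕ (Splits j))

        borel-basic : ∀ j → 𝓑 (basic j)
        borel-basic j = borel-Cell _ _

        analytic-A : ∀ j → Analytic ball² (A j)
        analytic-A j = analytic-∩ ball²-separating (proj₁ (borelRel⇒analytic bR))
          (analytic-∪ (analytic-proj₂⁻¹ (proj₂ (borel⇒analytic (borel-basic j))))
            (analytic-⋃ λ l → analytic-∩ ball²-separating
              (analytic-proj₂⁻¹ (proj₁ (borel⇒analytic (borel-basic l))))
              (analytic-proj₁⁻¹ (analytic-Dom (σ-∩ bR (borel-proj₂⁻¹
                (σ-∩ (borel-basic j) (complement (borel-basic l)))))))))

        empty-⋂A : Empty (⋂ ℕ A)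
        empty-⋂A (x , y) xy∈A =
          let xy = proj₁ (xy∈A 0)
              ys , section = finite x
              ε , 0<ε , iso = isolated y ys
              j , y∈ , close = basic-around y ε 0<ε
          in [ (λ y∉ → y∉ y∈)
             , (λ (l , y∈l , z , xz , z∈j , z∉l) →
                 z∉l (subst (_∈ basic l) (iso (section xz) (close z∈j)) y∈l)) ]′ (proj₂ (xy∈A j))

        isolates : ∀ {j x y z} → (x , y) ∉ A j → (x , z) ∉ A j → (x , y) ∈ R → (x , z) ∈ R → y ≡ z
        isolates {j} {x} {y} {z} y∉A z∉A xy xz = dne λ y≢z →
          let ε , 0<ε , apart = ≢⇒apart y≢z
              l , y∈l , close = basic-around y ε 0<ε
              z∈j = dne λ z∉j → z∉A (xz , inj₁ z∉j)
          in y∉A (xy , inj₂ (l , y∈l , z , xz , z∈j , λ z∈l → apart (close z∈l)))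

    borel-⨾ : ∀ {R S} → 𝓑² R → FiniteSections R → 𝓑² S → 𝓑² (R ⨾ S)
    borel-⨾ bR finite bS =
      let _ , bRⱼ , functional , R⊆ , ⊆R = functional-pieces bR finite
      in respects
           ( (λ (j , y , xy , s) → y , ⊆R (j , xy) , s)
           , (λ (y , xy , s) → let j , xyⱼ = R⊆ xy in j , y , xyⱼ , s) )
           (union λ j → borel-functional-⨾ (bRⱼ j) (functional j) bS)

    -- Two points are equal once they share a cell of every radius, which needs only countably many
    -- squares.
    borel-≡ : 𝓑² (uncurry _≡_)
    borel-≡ = respects (⊆≡ , λ { {x , _} refl n → let i , v = Cell-cover x n in i , v , v })
      (σ-⋂ λ n → union λ i → rectangle (borel-Cell i (radius n)) (borel-Cell i (radius n)))
      where
      ⊆≡ : ∀ {p} → (∀ n → ∃[ i ] p ∈ (Cell i (radius n) ⟨×⟩ Cell i (radius n))) → uncurry _≡_ p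
      ⊆≡ {x , y} common = close⇒≡ λ q 0<q →
        let n , r<     = small (half q) (half-positive 0<q)
            i , v , v′ = common n
        in subst (d x y <ᴿ_) (half+half q) (<-weaken (Cell-diameter v v′)
             (ℚ.+-mono-≤ (ℚ.<⇒≤ r<) (ℚ.<⇒≤ r<)))

    -- Connectedness in an induced graph with finite components

    module _ {Γ : Rel X 0ℓ} {Y : Pred X 0ℓ} (bΓ : BorelRel Γ) (bY : 𝓑 Y)
             (finite : ∀ x → x ∈ Y → Finite (component (Γ ↾ Y) x)) where

      private
        path : ℕ → Pred (X × X) 0ℓ
        path zero    = (Y ∘ proj₁) ∩ uncurry _≡_
        path (suc n) = uncurry (Γ ↾ Y) ⨾ path n

        finiteSections : FiniteSections (uncurry (Γ ↾ Y))
        finiteSections x with em {P = x ∈ Y}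
        ... | yes x∈Y = let _ , ys , _ , ⊆ys = finite x x∈Y in ys , λ edge → ⊆ys (edge ◅ Star.ε)
        ... | no x∉Y  = [] , λ (x∈Y , _) → contradiction x∈Y x∉Y

        borel-path : ∀ n → 𝓑² (path n)
        borel-path zero    = σ-∩ (borel-proj₁⁻¹ bY) borel-≡
        borel-path (suc n) = borel-⨾
          (σ-∩ (borel-proj₁⁻¹ bY) (σ-∩ (borel-proj₂⁻¹ bY) bΓ)) finiteSections (borel-path n)

        path⇒connected : ∀ n {x y} → (x , y) ∈ path n → x ∈ Y × Star (Γ ↾ Y) x y
        path⇒connected zero    (x∈Y , refl)                 = x∈Y , Star.ε
        path⇒connected (suc n) (y , edge@(x∈Y , _) , yz) =
          x∈Y , edge ◅ proj₂ (path⇒connected n yz)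

        connected⇒path : ∀ {x y} → x ∈ Y → Star (Γ ↾ Y) x y → ∃[ n ] (x , y) ∈ path n
        connected⇒path x∈Y Star.ε = 0 , x∈Y , refl
        connected⇒path x∈Y (edge@(_ , y∈Y , _) ◅ p) =
          let n , yz = connected⇒path y∈Y p in suc n , _ , edge , yz

      borel-connected : BorelRel (λ x y → x ∈ Y × Star (Γ ↾ Y) x y)
      borel-connected = respects
        ((λ (n , xy) → path⇒connected n xy) , λ (x∈Y , p) → connected⇒path x∈Y p)
        (union borel-path)

-- The toast

↾-preserves : {A : Set} {Γ : Rel A 0ℓ} {Y : Pred A 0ℓ} {x y : A} → x ∈ Y → Star (Γ ↾ Y) x y → y ∈ Y
↾-preserves x∈Y Star.ε                    = x∈Y
↾-preserves x∈Y ((_ , y∈Y , _) ◅ p) = ↾-preserves y∈Y p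

theorem4p12 : (∀ {ℓ} → ExcludedMiddle ℓ) →
    (𝕏 : StandardBorelSpace) →
    let open StandardBorelSpace 𝕏 renaming (Carrier to X) in
    (Γ : Rel X 0ℓ) → IsBorelGraph 𝕏 Γ →
    (d : ℕ) → 2 ≤ d →
    (Xs : ℕ → Pred X 0ℓ) (P Q : ℕ) →
    IsBoundedGeometryWOD 𝕏 Γ Xs P Q →
    d * P ≤ Q →
    BorelUnlayeredToast 𝕏 Γ
theorem4p12 em 𝕏 Γ borelGraph _ _ Xs _ _ wod _ = record
  { dom             = Y
  ; T               = T
  ; isEquivalenceOn = λ n → record
    { supported            = λ (x∈Y , p) → x∈Y , ↾-preserves x∈Y p
    ; reflexive            = λ x∈Y → x∈Y , Star.ε
    ; isPartialEquivalence = record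
      { sym   = λ (x∈Y , p) → ↾-preserves x∈Y p , reverse n p
      ; trans = λ (x∈Y , p) (_ , q) → x∈Y , p ◅◅ q
      }
    }
  ; T⊆EΓ            = λ n (_ , p) → Star.map (proj₂ ∘ proj₂) p
  ; finiteClasses   = λ n x x∈Y →
      let k , ys , len , ⊆ys = finiteRegions n x x∈Y in k , ys , len , ⊆ys ∘ proj₂
  ; covers          = λ x → ¬∀⇒∃¬ (vanishing x)
  ; nested          = λ n m n<m x x′ _ x′∈Y (z , (_ , xz) , (_ , x′z)) (_ , xy) →
      x′∈Y , x′z ◅◅ widen (ℕ.<⇒≤ n<m) (reverse n xz ◅◅ xy)
  ; absorbed        = absorbed
  ; borelDom        = fromσ ∘ borel-Y
  ; borelT          = λ n → borel-connected (IsBorelGraph.borel borelGraph) (borel-Y n) (finiteRegions n)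
  }
  where
  open IsBoundedGeometryWOD wod
  open Classical em
  open FiniteSections 𝕏
  open StandardBorelSpace 𝕏 using () renaming (Carrier to X)

  Y : ℕ → Pred X 0ℓ
  Y n = ∁ ((𝕏 ^∞) Xs n)

  T : ℕ → Rel X 0ℓ
  T n x y = x ∈ Y n × Star (Γ ↾ Y n) x y

  borel-Y : ∀ n → 𝓑 (Y n)
  borel-Y n = complement (union λ k → σ-∩ (σ-const (n ≤ k)) (toσ (borel k)))

  reverse : ∀ n {x y} → Star (Γ ↾ Y n) x y → Star (Γ ↾ Y n) y x
  reverse n = Star.reverse λ (x∈Y , y∈Y , edge) → y∈Y , x∈Y , IsBorelGraph.symmetric borelGraph edge

  Y-mono : ∀ {n m} → n ≤ m → Y n ⊆ Y m
  Y-mono n≤m x∈Y (k , m≤k , x∈X) = x∈Y (k , ℕ.≤-trans n≤m m≤k , x∈X)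

  widen : ∀ {n m x y} → n ≤ m → Star (Γ ↾ Y n) x y → Star (Γ ↾ Y m) x y
  widen n≤m = Star.map λ (x∈Y , y∈Y , edge) → Y-mono n≤m x∈Y , Y-mono n≤m y∈Y , edge

  absorbed : ∀ n x → x ∈ Y n → ∃[ m ] n ℕ.< m ×
    (∃[ x′ ] x′ ∈ Y m × T n x ⊆ T m x′ ∩ ∁ (∂[ Γ ] (T m x′)))
  absorbed n x x∈Y = m , n<m , x , Y-mono n≤m x∈Y , λ (_ , xz) →
      (Y-mono n≤m x∈Y , widen n≤m xz) , interior xz
    where
    touched = proj₁ polygonalBound n x x∈Y
    -- Exceeds n and every index k ≥ n for which `Xs k` is at distance 1 from the class of x; 0 is
    -- the maximum of an empty list.
    m = suc (n ⊔ max 0 (proj₁ touched))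
    n<m = s≤s (ℕ.m≤m⊔n n _)
    n≤m = ℕ.<⇒≤ n<m

    -- Distance 0 would put a point of the region into `Xs k`, although the region avoids these
    -- sets. So a single edge into `Xs k` makes the distance exactly 1.
    disjoint : ∀ {k} → n ≤ k → ∀ l → ρ[ Γ ] region 𝕏 Γ Xs n x , Xs k ≤ l → 1 ≤ l
    disjoint n≤k (suc l) _ = s≤s z≤n
    disjoint n≤k zero (u , _ , xu , u∈X , Star.ε , _) = contradiction (_ , n≤k , u∈X) (↾-preserves x∈Y xu)
    disjoint n≤k zero (_ , _ , _ , _ , _ ◅ _ , ())

    -- If y were in some `Xs k` with m ≤ k, the edge would put k on the list `touched`, all of whose
    -- entries are below m.
    neighbour : ∀ {z y} → Star (Γ ↾ Y n) x z → Γ z y → y ∈ Y m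
    neighbour xz edge (k , m≤k , y∈X) = ℕ.<⇒≱ (s≤s (ℕ.≤-trans k≤max (ℕ.m≤n⊔m n _))) m≤k
      where
      n≤k = ℕ.≤-trans n≤m m≤k
      k≤max = All.lookup (xs≤max 0 _) (proj₂ (proj₂ touched)
        (n≤k , (_ , _ , xz , y∈X , edge ◅ Star.ε , s≤s z≤n) , disjoint n≤k))

    interior : ∀ {z} → Star (Γ ↾ Y n) x z → z ∉ ∂[ Γ ] (T m x)
    interior xz (z∈T , (_ , _ , refl , y∉T , Star.ε , _) , _) = y∉T z∈T
    interior xz ((x∈Ym , xz′) , (_ , _ , refl , y∉T , edge ◅ Star.ε , _) , _) =
      y∉T (x∈Ym , xz′ ◅◅ (↾-preserves x∈Ym xz′ , neighbour xz edge , edge) ◅ Star.ε)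
    interior xz (_ , (_ , _ , _ , _ , _ ◅ _ ◅ _ , s≤s ()) , _)
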